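{- Let $\mathbf H$ be a finite connected ordered hypergraph. The generalised flip order $\leq$, i.e. the reflexive and transitive closure of the covering relation $\lessdot$ on the set of all constructs of $\mathbf H$, is a partial order.
   Context: A (finite) hypergraph $\mathbf H$ with finite vertex set $H$ is a set of non-empty subsets of $H$ (hyperedges) with $\bigcup\mathbf H=H$ and $\{x\}\in\mathbf H$ for all $x\in H$. For $X\subseteq H$, $\mathbf H_X:=\{Z\in\mathbf H: Z\subseteq X\}$ and $\mathbf H\setminus X:=\mathbf H_{H\setminus X}$. $\mathbf H$ is connected if there is no partition $H=X_1\cup X_2$ into two non-empty parts with $\mathbf H=\mathbf H_{X_1}\cup\mathbf H_{X_2}$. Every hypergraph is uniquely the union of its connected components; $\mathbf H,X\leadsto H_1,\dots,H_n$ means that $\mathbf H_{H_1},\dots,\mathbf H_{H_n}$ are the connected components of $\mathbf H\setminus X$. Constructs of a connected hypergraph $\mathbf H$ are non-planar rooted trees with nodes labelled by non-empty subsets of $H$, defined recursively: the one-node tree labelled $H$ is a construct of $\mathbf H$; if $\emptyset\neq Y\subsetneq H$, $\mathbf H,Y\leadsto H_1,\dots,H_n$, and $T_i$ is a construct of $\mathbf H_{H_i}$ for each $i$, then the tree $Y(T_1,\dots,T_n)$ with root $Y$ and immediate subtrees $T_1,\dots,T_n$ is a construct of $\mathbf H$. Nodes are identified with their labels (the labels partition $H$). $\mathbf H$ is ordered if $H$ carries a total order; for non-empty $Y,Z\subseteq H$, $Y<Z$ (or $Z>Y$) means $\max Y<\min Z$. If in a construct $S$ the node $X$ is the parent of the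 node $Y$, contracting the edge between them and labelling the merged node $X\cup Y$ yields a construct $T$; write $S\subset_{X,Y}T$. For constructs $S,S'$ of $\mathbf H$, $S\lessdot S'$ iff there exist $U,V$ with $U>V$ such that either $S\subset_{U,V}S'$ (fusion) or $S'\subset_{V,U}S$ (split). -}

module Defs where

open import Level using (0ℓ)
open import Data.Nat.Base using (ℕ)
open import Data.Fin.Base using (Fin)
open import Data.Fin.Subset
  using (Subset; _∈_; _⊆_; _⊂_; _∪_; _∩_; _─_; ⋃; ⁅_⁆; Nonempty; Empty)
open import Data.List.Base using (List; []; _∷_; _++_)
open import Data.List.Relation.Unary.All using (All)
open import Data.List.Relation.Unary.Any using (Any)
open import Data.List.Relation.Unary.AllPairs using (AllPairs)
open import Data.List.Relation.Binary.Pointwise using (Pointwise)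
open import Data.List.Relation.Binary.Permutation.Homogeneous using (Permutation)
open import Data.Product.Base using (∃; ∃₂; Σ; _×_; proj₁)
open import Data.Sum.Base using (_⊎_)
open import Function.Bundles using (_⇔_)
open import Relation.Binary.Core using (Rel)
open import Relation.Binary.Construct.Closure.ReflexiveTransitive using (Star)
open import Relation.Binary.PropositionalEquality.Core using (_≡_; _≢_)
open import Relation.Nullary.Negation.Core using (¬_)
open import Relation.Unary using (Pred; Decidable; _≐_) renaming (_∪_ to _∪ᵖ_)

private
  variable
    n : ℕ

-- Vertices are drawn from Fin n. The vertex set H is a subset of it, so that
-- a hypergraph and its restrictions have the same type; H may be all of Fin n.
-- Decidable membership makes 𝐇 a finite set in the constructive sense.

Hyperedges : ℕ → Set₁
Hyperedges n = Pred (Subset n) 0ℓ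

record IsHypergraph (𝐇 : Hyperedges n) (H : Subset n) : Set where
  field
    decidable  : Decidable 𝐇
    nonempty   : ∀ Z → 𝐇 Z → Nonempty Z
    cover      : ∀ x → (x ∈ H) ⇔ (∃ λ Z → 𝐇 Z × x ∈ Z)
    singletons : ∀ x → x ∈ H → 𝐇 ⁅ x ⁆

infixl 7 _↾_
_↾_ : Hyperedges n → Subset n → Hyperedges n
(𝐇 ↾ X) Z = 𝐇 Z × Z ⊆ X

Connected : Hyperedges n → Subset n → Set
Connected 𝐇 H = ¬ (∃₂ λ X₁ X₂ →
  Nonempty X₁ × Nonempty X₂ × Empty (X₁ ∩ X₂) × X₁ ∪ X₂ ≡ H ×
  𝐇 ≐ (𝐇 ↾ X₁ ∪ᵖ 𝐇 ↾ X₂))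

-- Ks lists, in some order and without repetition, the vertex sets of the
-- connected components of the hypergraph 𝐇 on H. Non-emptiness is required
-- because the empty hypergraph satisfies Connected vacuously.

record IsComponents (𝐇 : Hyperedges n) (H : Subset n) (Ks : List (Subset n)) : Set where
  field
    nonempty  : All Nonempty Ks
    disjoint  : AllPairs (λ K L → Empty (K ∩ L)) Ks
    connected : All (λ K → Connected (𝐇 ↾ K) K) Ks
    vertices  : ⋃ Ks ≡ H
    edges     : 𝐇 ≐ (λ Z → Any (λ K → (𝐇 ↾ K) Z) Ks)

-- 𝐇 , X ⇝ Ks, where H is the vertex set of 𝐇.
Decomposes : Hyperedges n → Subset n → Subset n → List (Subset n) → Set
Decomposes 𝐇 H X Ks = IsComponents (𝐇 ↾ (H ─ X)) (H ─ X) Ks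

data Tree (n : ℕ) : Set where
  node : Subset n → List (Tree n) → Tree n

-- Non-planar trees are planar trees up to reordering of immediate subtrees,
-- at every depth; _≅_ is their equality.

infix 4 _≅_
data _≅_ {n : ℕ} : Rel (Tree n) 0ℓ where
  node : ∀ {X Ts Us} → Permutation _≅_ Ts Us → node X Ts ≅ node X Us

data IsConstruct {n : ℕ} (𝐇 : Hyperedges n) (H : Subset n) : Tree n → Set where
  single : Nonempty H → IsConstruct 𝐇 H (node H [])
  graft  : ∀ {Y Ks Ts} → Nonempty Y → Y ⊂ H → Decomposes 𝐇 H Y Ks →
           Pointwise (λ K T → IsConstruct (𝐇 ↾ K) K T) Ks Ts →
           IsConstruct 𝐇 H (node Y Ts)

Construct : Hyperedges n → Subset n → Set
Construct 𝐇 H = Σ (Tree _) (IsConstruct 𝐇 H)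

infix 4 _≅ᶜ_
_≅ᶜ_ : {𝐇 : Hyperedges n} {H : Subset n} → Rel (Construct 𝐇 H) 0ℓ
S ≅ᶜ T = proj₁ S ≅ proj₁ T

-- Contraction of the edge from the parent X to its child Y, on planar trees.

data Contracts {n : ℕ} (X Y : Subset n) : Rel (Tree n) 0ℓ where
  here  : ∀ Ls Us Rs →
          Contracts X Y (node X (Ls ++ node Y Us ∷ Rs))
                        (node (X ∪ Y) (Ls ++ Us ++ Rs))
  there : ∀ Z Ls Rs {T T′} → Contracts X Y T T′ →
          Contracts X Y (node Z (Ls ++ T ∷ Rs)) (node Z (Ls ++ T′ ∷ Rs))

-- S ⊂[ X , Y ] T, on non-planar trees.

infix 4 _⊂[_,_]_
_⊂[_,_]_ : Tree n → Subset n → Subset n → Tree n → Set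
S ⊂[ X , Y ] T = ∃₂ λ S′ T′ → S ≅ S′ × Contracts X Y S′ T′ × T′ ≅ T

module _ {n : ℕ} (_≼_ : Rel (Fin n) 0ℓ) where

  IsMax IsMin : Subset n → Fin n → Set
  IsMax Y m = m ∈ Y × (∀ y → y ∈ Y → y ≼ m)
  IsMin Y m = m ∈ Y × (∀ y → y ∈ Y → m ≼ y)

  -- max Y < min Z; in particular Y and Z are non-empty.
  Below : Rel (Subset n) 0ℓ
  Below Y Z = ∃₂ λ a b → IsMax Y a × IsMin Z b × a ≼ b × a ≢ b

  module _ (𝐇 : Hyperedges n) (H : Subset n) where

    data Cover (S S′ : Construct 𝐇 H) : Set where
      fusion : ∀ {U V} → Below V U → proj₁ S ⊂[ U , V ] proj₁ S′ → Cover S S′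
      split  : ∀ {U V} → Below V U → proj₁ S′ ⊂[ V , U ] proj₁ S → Cover S S′

    -- Reflexive with respect to _≅ᶜ_, the equality of constructs.
    FlipOrder : Rel (Construct 𝐇 H) 0ℓ
    FlipOrder = Star (λ S S′ → S ≅ᶜ S′ ⊎ Cover S S′)

{-# OPTIONS --safe #-}
module Submission where

open import Defs
open import Level using (0ℓ)
open import Data.Nat.Base using (ℕ)
open import Data.Fin.Base using (Fin)
open import Data.Fin.Subset using (Subset)
open import Relation.Binary.Core using (Rel)
open import Relation.Binary.Structures using (IsTotalOrder; IsPartialOrder)
open import Relation.Binary.PropositionalEquality.Core using (_≡_)

open import Data.Empty using (⊥; ⊥-elim)
open import Data.Fin.Subset using (_∈_; _⊆_; _∪_; _∩_; _─_; ⋃; Nonempty; Empty)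
open import Data.Fin.Subset.Properties
open import Data.List.Base using (List; []; _∷_; _++_)
open import Data.List.Membership.Propositional using (find) renaming (_∈_ to _∈ˡ_)
open import Data.List.Relation.Unary.All as All using (All; []; _∷_)
import Data.List.Relation.Unary.All.Properties as All
open import Data.List.Relation.Unary.AllPairs using (AllPairs; []; _∷_)
open import Data.List.Relation.Unary.Any as Any using (Any; here; there)
import Data.List.Relation.Unary.Any.Properties as Any
open import Data.List.Relation.Binary.Permutation.Homogeneous as Homogeneous
  using (Permutation; refl; prep; swap; trans)
import Data.List.Relation.Binary.Permutation.Setoid.Properties as ↭-Properties
open import Data.List.Relation.Binary.Pointwise as Pointwise using (Pointwise; []; _∷_)
open import Data.Product.Base as Product using (∃; _×_; _,_; proj₁; proj₂)
open import Data.Sum.Base as Sum using (_⊎_; inj₁; inj₂)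
open import Data.Vec.Base using (_∷_; here; there)
open import Function.Base using (_∘_; flip)
open import Function.Bundles using (Equivalence)
open import Relation.Binary.Construct.Closure.ReflexiveTransitive using (ε; _◅_; _◅◅_)
open import Relation.Binary.Definitions using (Reflexive; Symmetric; Transitive)
import Relation.Binary.PropositionalEquality as ≡
open import Relation.Nullary using (¬_; yes; no)
open import Relation.Unary using (Pred; _≐_)
open import Relation.Unary.Properties using (≐-sym)

-- Given a construct, a connected set Z of vertices meets a unique topmost node
-- among those it meets; call the part of Z in that node the top of Z. Along a
-- covering step neither the maximum nor the minimum of the top of Z goes up.
-- If the step merges or separates the nodes U and V, and Z is the vertex set
-- of the subtree they root, then one of the two goes strictly down. So a
-- cycle in the flip order contains no covering step.

private
  variable
    n : ℕ
    H X Y Z : Subset n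
    𝐇 : Hyperedges n
    S T : Tree n
    Ks : List (Subset n)
    Ts Us : List (Tree n)

-- Equality of non-planar trees is an equivalence.

mutual
  ≅-refl : Reflexive (_≅_ {n})
  ≅-refl {x = node X Ts} = node (refl (≅-refl* Ts))

  ≅-refl* : (Ts : List (Tree n)) → Pointwise _≅_ Ts Ts
  ≅-refl* []       = []
  ≅-refl* (T ∷ Ts) = ≅-refl ∷ ≅-refl* Ts

mutual
  ≅-sym : Symmetric (_≅_ {n})
  ≅-sym (node p) = node (permutation-sym p)

  -- Spelled out by recursion on the permutation: `_≅_` is nested inside `Permutation`, and `≅-sym`
  -- must visibly be applied to smaller proofs.
  permutation-sym : Symmetric (Permutation (_≅_ {n}))
  permutation-sym (refl es)    = refl (pointwise-sym es)
  permutation-sym (prep e p)   = prep (≅-sym e) (permutation-sym p)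
  permutation-sym (swap e f p) = swap (≅-sym f) (≅-sym e) (permutation-sym p)
  permutation-sym (trans p q)  = trans (permutation-sym q) (permutation-sym p)

  pointwise-sym : Symmetric (Pointwise (_≅_ {n}))
  pointwise-sym []       = []
  pointwise-sym (e ∷ es) = ≅-sym e ∷ pointwise-sym es

≅-trans : Transitive (_≅_ {n})
≅-trans (node p) (node q) = node (trans p q)

-- Finite subsets and lists.

∈⋃⁻ : ∀ Ks {x : Fin n} → x ∈ ⋃ Ks → Any (x ∈_) Ks
∈⋃⁻ []       x∈⊥ = ⊥-elim (∉⊥ x∈⊥)
∈⋃⁻ (K ∷ Ks) x∈  = Sum.[ here , there ∘ ∈⋃⁻ Ks ]′ (x∈p∪q⁻ K (⋃ Ks) x∈)

∈⋃⁺ : {x : Fin n} → Any (x ∈_) Ks → x ∈ ⋃ Ks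
∈⋃⁺ (here x∈K) = x∈p∪q⁺ (inj₁ x∈K)
∈⋃⁺ (there x∈) = x∈p∪q⁺ (inj₂ (∈⋃⁺ x∈))

x∈p─q⇒x∉q : ∀ (p q : Subset n) {x} → x ∈ p ─ q → ¬ x ∈ q
x∈p─q⇒x∉q (_ ∷ p) (_ ∷ q) (there x∈p─q) (there x∈q) = x∈p─q⇒x∉q p q x∈p─q x∈q

AllPairs-compare : ∀ {A : Set} {R : Rel A 0ℓ} → Symmetric R → ∀ {xs} → AllPairs R xs →
                   ∀ {x y} → x ∈ˡ xs → y ∈ˡ xs → x ≡ y ⊎ R x y
AllPairs-compare sym (_ ∷ _)  (here ≡.refl) (here ≡.refl) = inj₁ ≡.refl
AllPairs-compare sym (r ∷ _)  (here ≡.refl) (there j)     = inj₂ (All.lookup r j)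
AllPairs-compare sym (r ∷ _)  (there i)     (here ≡.refl) = inj₂ (sym (All.lookup r i))
AllPairs-compare sym (_ ∷ rs) (there i)     (there j)     = AllPairs-compare sym rs i j

-- Used with `R` the relation `Separated Z` and `y` a subtree already known to contain a top vertex
-- of `Z`: the second alternative is then contradictory.
AllPairs-focus : ∀ {A : Set} {R : Rel A 0ℓ} {P : Pred A 0ℓ} → Symmetric R →
                 ∀ xs {y zs} → AllPairs R (xs ++ y ∷ zs) → Any P (xs ++ y ∷ zs) →
                 P y ⊎ ∃ λ x → R y x × P x
AllPairs-focus sym []       (r ∷ _)  (here py)  = inj₁ py
AllPairs-focus sym []       (r ∷ _)  (there pz) = inj₂ (_ , All.lookupAny r pz)
AllPairs-focus sym (x ∷ xs) (r ∷ _)  (here px)  = inj₂ (x , sym (All.head (All.++⁻ʳ xs r)) , px)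
AllPairs-focus sym (x ∷ xs) (_ ∷ rs) (there p)  = AllPairs-focus sym xs rs p

-- For a contraction inside the subtree `y`: a witness found elsewhere in the list survives whatever
-- `y` becomes.
Any-replace : ∀ {A : Set} {P : Pred A 0ℓ} xs {y zs} → Any P (xs ++ y ∷ zs) →
              P y ⊎ (∀ y′ → Any P (xs ++ y′ ∷ zs))
Any-replace []       (here py)  = inj₁ py
Any-replace []       (there pz) = inj₂ λ _ → there pz
Any-replace (x ∷ xs) (here px)  = inj₂ λ _ → here px
Any-replace (x ∷ xs) (there p)  = Sum.map₂ (λ f y′ → there (f y′)) (Any-replace xs p)

∩-Empty-sym : Symmetric (λ (K L : Subset n) → Empty (K ∩ L))
∩-Empty-sym {x = K} {L} = ≡.subst Empty (∩-comm K L)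

-- Constructs are stable under reordering of subtrees.

module _ {n : ℕ} where
  private
    module ↭ = ↭-Properties (≡.setoid (Subset n))

  IsComponents-resp-↭ : ∀ {𝐇 : Hyperedges n} {H Ks Ls} → Permutation _≡_ Ks Ls →
                        IsComponents 𝐇 H Ks → IsComponents 𝐇 H Ls
  IsComponents-resp-↭ p c = record
    { nonempty  = ↭.All-resp-↭ (≡.subst _) p nonempty
    ; disjoint  = ↭.AllPairs-resp-↭ ∩-Empty-sym (≡.resp₂ _) p disjoint
    ; connected = ↭.All-resp-↭ (≡.subst _) p connected
    ; vertices  = ≡.trans (≡.sym (↭.foldr-commMonoid (∪-isCommutativeMonoid n) p)) vertices
    ; edges     = (λ e → ↭.Any-resp-↭ (≡.subst _) p (proj₁ edges e))
                , (λ e → proj₂ edges (↭.Any-resp-↭ (≡.subst _) (↭-sym p) e))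
    }
    where
    open IsComponents c
    ↭-sym : Symmetric (Permutation _≡_)
    ↭-sym = Homogeneous.sym ≡.sym

permutation-[] : Permutation _≅_ Ts Us → Ts ≡ [] → Us ≡ []
permutation-[] (refl [])   ≡.refl = ≡.refl
permutation-[] (trans p q) eq     = permutation-[] q (permutation-[] p eq)

Components-construct : Hyperedges n → List (Subset n) → List (Tree n) → Set
Components-construct 𝐇 = Pointwise (λ K T → IsConstruct (𝐇 ↾ K) K T)

mutual
  -- Contraction acts on planar representatives, so being a construct has to be transported to them.
  IsConstruct-resp-≅ : S ≅ T → IsConstruct 𝐇 H S → IsConstruct 𝐇 H T
  IsConstruct-resp-≅ (node p) (single ne) with permutation-[] p ≡.refl
  ... | ≡.refl = single ne
  IsConstruct-resp-≅ (node p) (graft ne Y⊂H d cs) with permute-components p cs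
  ... | _ , q , cs′ = graft ne Y⊂H (IsComponents-resp-↭ q d) cs′

  -- Components and subtrees are paired by position, so a reordering of the subtrees is matched by
  -- the same reordering of the components.
  permute-components : Permutation _≅_ Ts Us → Components-construct 𝐇 Ks Ts →
                       ∃ λ Ls → Permutation _≡_ Ks Ls × Components-construct 𝐇 Ls Us
  permute-components (refl es) cs =
    _ , refl (Pointwise.refl ≡.refl) , components-resp-≅ es cs
  permute-components (prep e p) (c ∷ cs) with permute-components p cs
  ... | _ , q , cs′ = _ , prep ≡.refl q , IsConstruct-resp-≅ e c ∷ cs′
  permute-components (swap e f p) (c ∷ d ∷ cs) with permute-components p cs
  ... | _ , q , cs′ = _ , swap ≡.refl ≡.refl q ,
                      IsConstruct-resp-≅ f d ∷ IsConstruct-resp-≅ e c ∷ cs′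
  permute-components (trans p p′) cs with permute-components p cs
  ... | _ , q , cs′ with permute-components p′ cs′
  ... | _ , q′ , cs″ = _ , trans q q′ , cs″

  components-resp-≅ : Pointwise _≅_ Ts Us → Components-construct 𝐇 Ks Ts →
                      Components-construct 𝐇 Ks Us
  components-resp-≅ []       []       = []
  components-resp-≅ (e ∷ es) (c ∷ cs) = IsConstruct-resp-≅ e c ∷ components-resp-≅ es cs

-- The top of a vertex set in a tree.

-- The search goes below a node only if its label misses `Z`. Nothing here makes the topmost node
-- unique: an arbitrary `Z` may collect vertices from several subtrees. Uniqueness comes from
-- connectedness, through `Separated`.
data Top {n : ℕ} (Z : Subset n) : Tree n → Fin n → Set where
  root  : ∀ {X Ts x} → x ∈ Z → x ∈ X → Top Z (node X Ts) x
  below : ∀ {X Ts x} → Empty (Z ∩ X) → Any (λ T → Top Z T x) Ts → Top Z (node X Ts) x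

mutual
  Top-resp-≅ : S ≅ T → ∀ {x} → Top Z S x → Top Z T x
  Top-resp-≅ (node p) (root x∈Z x∈X) = root x∈Z x∈X
  Top-resp-≅ (node p) (below e t)    = below e (Top-permute p t)

  Top-permute : Permutation _≅_ Ts Us → ∀ {x} →
                Any (λ T → Top Z T x) Ts → Any (λ T → Top Z T x) Us
  Top-permute (refl es)    t                 = Top-pointwise es t
  Top-permute (prep e p)   (here t)          = here (Top-resp-≅ e t)
  Top-permute (prep e p)   (there t)         = there (Top-permute p t)
  Top-permute (swap e f p) (here t)          = there (here (Top-resp-≅ e t))
  Top-permute (swap e f p) (there (here t))  = here (Top-resp-≅ f t)
  Top-permute (swap e f p) (there (there t)) = there (there (Top-permute p t))
  Top-permute (trans p q)  t                 = Top-permute q (Top-permute p t)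

  Top-pointwise : Pointwise _≅_ Ts Us → ∀ {x} →
                  Any (λ T → Top Z T x) Ts → Any (λ T → Top Z T x) Us
  Top-pointwise (e ∷ es) (here t)  = here (Top-resp-≅ e t)
  Top-pointwise (e ∷ es) (there t) = there (Top-pointwise es t)

mutual
  Top⇒∈ : ∀ {x} → Top Z T x → x ∈ Z
  Top⇒∈ (root x∈Z _) = x∈Z
  Top⇒∈ (below _ t)  = Top*⇒∈ t

  Top*⇒∈ : ∀ {x} → Any (λ T → Top Z T x) Ts → x ∈ Z
  Top*⇒∈ (here t)  = Top⇒∈ t
  Top*⇒∈ (there t) = Top*⇒∈ t

label-⊆ : IsConstruct 𝐇 H (node X Ts) → X ⊆ H
label-⊆ (single _)        = λ x∈ → x∈
label-⊆ (graft _ Y⊂H _ _) = proj₁ Y⊂H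

label-nonempty : IsConstruct 𝐇 H (node X Ts) → Nonempty X
label-nonempty (single ne)      = ne
label-nonempty (graft ne _ _ _) = ne

mutual
  Top⇒∈vertices : ∀ {x} → IsConstruct 𝐇 H T → Top Z T x → x ∈ H
  Top⇒∈vertices c (root _ x∈X) = label-⊆ c x∈X
  Top⇒∈vertices {H = H} (graft {Y} _ _ d cs) (below _ t) =
    p─q⊆p H Y (≡.subst (_ ∈_) (IsComponents.vertices d) (∈⋃⁺ (Top*⇒∈vertices cs t)))

  Top*⇒∈vertices : ∀ {x} → Components-construct 𝐇 Ks Ts →
                   Any (λ T → Top Z T x) Ts → Any (x ∈_) Ks
  Top*⇒∈vertices (c ∷ _)  (here t)  = here (Top⇒∈vertices c t)
  Top*⇒∈vertices (_ ∷ cs) (there t) = there (Top*⇒∈vertices cs t)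

-- Connected sets and components.

Connected-resp-≐ : {𝐀 𝐁 : Hyperedges n} → 𝐀 ≐ 𝐁 → Connected 𝐀 H → Connected 𝐁 H
Connected-resp-≐ (𝐀⊆𝐁 , 𝐁⊆𝐀) conn (X₁ , X₂ , ne₁ , ne₂ , dis , cov , to , from) =
  conn (X₁ , X₂ , ne₁ , ne₂ , dis , cov
       , (λ e → Sum.map (Product.map₁ 𝐁⊆𝐀) (Product.map₁ 𝐁⊆𝐀) (to (𝐀⊆𝐁 e)))
       , (λ e → 𝐁⊆𝐀 (from (Sum.map (Product.map₁ 𝐀⊆𝐁) (Product.map₁ 𝐀⊆𝐁) e))))

↾-↾ : {𝐇 : Hyperedges n} {K Z : Subset n} → Z ⊆ K → 𝐇 ↾ K ↾ Z ≐ 𝐇 ↾ Z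
↾-↾ Z⊆K = (λ ((e , _) , E⊆Z) → e , E⊆Z) , (λ (e , E⊆Z) → (e , Z⊆K ∘ E⊆Z) , E⊆Z)

-- The second alternative makes the condition hereditary: once `Z` misses the root label, it lies
-- inside one component or misses it, and both cases must be carried down the tree.
Within : Hyperedges n → Subset n → Subset n → Set
Within 𝐇 H Z = (Z ⊆ H × Connected (𝐇 ↾ Z) Z) ⊎ Empty (Z ∩ H)

module _ {𝐇 : Hyperedges n} {H Y : Subset n} {Ks : List (Subset n)} (d : Decomposes 𝐇 H Y Ks) where
  open IsComponents d

  component-⊆ : ∀ {K} → K ∈ˡ Ks → K ⊆ H ─ Y
  component-⊆ i x∈K = ≡.subst (_ ∈_) vertices (∈⋃⁺ (Any.map (λ { ≡.refl → x∈K }) i))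

  -- If Z met K without lying in K, then Z ∩ K and Z ─ K would disconnect it.
  component-absorbs : ∀ {Z K} → Z ⊆ H → Connected (𝐇 ↾ Z) Z → Empty (Z ∩ Y) →
                      K ∈ˡ Ks → Nonempty (Z ∩ K) → Z ⊆ K
  component-absorbs {Z} {K} Z⊆H conn Z∩Y=∅ i meets {z} z∈Z with z ∈? K
  ... | yes z∈K = z∈K
  ... | no  z∉K = ⊥-elim (conn
    ( Z ∩ K , Z ─ K , meets , (z , x∈p∧x∉q⇒x∈p─q z∈Z z∉K)
    , (λ (x , x∈) → let x∈Z∩K , x∈Z─K = x∈p∩q⁻ (Z ∩ K) (Z ─ K) x∈ in
                    x∈p─q⇒x∉q Z K x∈Z─K (p∩q⊆q Z K x∈Z∩K))
    , ⊆-antisym (λ x∈ → Sum.[ p∩q⊆p Z K , p─q⊆p Z K ]′ (x∈p∪q⁻ (Z ∩ K) (Z ─ K) x∈)) Z⊆parts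
    , edge-splits , Sum.[ proj₁ , proj₁ ]′ ))
    where
    Z⊆parts : Z ⊆ (Z ∩ K) ∪ (Z ─ K)
    Z⊆parts {x} x∈Z with x ∈? K
    ... | yes x∈K = x∈p∪q⁺ (inj₁ (x∈p∩q⁺ (x∈Z , x∈K)))
    ... | no  x∉K = x∈p∪q⁺ (inj₂ (x∈p∧x∉q⇒x∈p─q x∈Z x∉K))

    edge-splits : ∀ {E} → (𝐇 ↾ Z) E → (𝐇 ↾ Z ↾ (Z ∩ K)) E ⊎ (𝐇 ↾ Z ↾ (Z ─ K)) E
    edge-splits {E} (e , E⊆Z)
      -- Since `Z` avoids `Y`, the edge `E` lies in `H ─ Y` and hence in a component `L`. Either `L`
      -- is `K` or the two are disjoint, which decides the side of `E`.
      with L , j , _ , E⊆L ← find (proj₁ edges (e , λ {x} x∈E →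
             x∈p∧x∉q⇒x∈p─q (Z⊆H (E⊆Z x∈E)) (λ x∈Y → Z∩Y=∅ (x , x∈p∩q⁺ (E⊆Z x∈E , x∈Y)))))
      with AllPairs-compare ∩-Empty-sym disjoint i j
    ... | inj₁ ≡.refl = inj₁ ((e , E⊆Z) , λ x∈E → x∈p∩q⁺ (E⊆Z x∈E , E⊆L x∈E))
    ... | inj₂ K∩L=∅  = inj₂ ((e , E⊆Z) , λ {x} x∈E →
            x∈p∧x∉q⇒x∈p─q (E⊆Z x∈E) (λ x∈K → K∩L=∅ (x , x∈p∩q⁺ (x∈K , E⊆L x∈E))))

  -- By `component-absorbs`, a connected `Z` that meets `K` lies in `K`. This carries the hypothesis
  -- on `Z` through every induction on constructs.
  Within-component : ∀ {Z} → Within 𝐇 H Z → Empty (Z ∩ Y) →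
                     ∀ {K} → K ∈ˡ Ks → Within (𝐇 ↾ K) K Z
  Within-component {Z} w Z∩Y=∅ {K} i with nonempty? (Z ∩ K) | w
  ... | no  Z∩K=∅ | _ = inj₂ Z∩K=∅
  ... | yes (x , x∈) | inj₂ Z∩H=∅ =
    let x∈Z , x∈K = x∈p∩q⁻ Z K x∈ in
    ⊥-elim (Z∩H=∅ (x , x∈p∩q⁺ (x∈Z , p─q⊆p H Y (component-⊆ i x∈K))))
  ... | yes meets | inj₁ (Z⊆H , conn) =
    let Z⊆K = component-absorbs Z⊆H conn Z∩Y=∅ i meets in
    inj₁ ((λ {x} → Z⊆K {x}) , Connected-resp-≐ (≐-sym (↾-↾ Z⊆K)) conn)

-- Separation of sibling subtrees.

-- Required of all pairs of siblings, this is the working form of the uniqueness of the topmost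
-- node.
Separated : Subset n → Rel (Tree n) 0ℓ
Separated Z S T = ∀ x y → Top Z S x → Top Z T y → ⊥

Separated-sym : Symmetric (Separated Z)
Separated-sym sep x y s t = sep y x t s

-- If `Z` lies in `K`, a top vertex in `T` would lie in both `K` and `L`; if `Z` misses `K`, there
-- is no top vertex in `S`.
Separated-components : ∀ {K L} → Empty (K ∩ L) → Within (𝐇 ↾ K) K Z →
                       IsConstruct (𝐇 ↾ K) K S → IsConstruct (𝐇 ↾ L) L T → Separated Z S T
Separated-components K∩L=∅ (inj₁ (Z⊆K , _)) c d x y s t =
  K∩L=∅ (y , x∈p∩q⁺ (Z⊆K (Top⇒∈ t) , Top⇒∈vertices d t))
Separated-components K∩L=∅ (inj₂ Z∩K=∅) c d x y s t =
  Z∩K=∅ (x , x∈p∩q⁺ (Top⇒∈ s , Top⇒∈vertices c s))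

subtrees-separated : AllPairs (λ K L → Empty (K ∩ L)) Ks → All (λ K → Within (𝐇 ↾ K) K Z) Ks →
                     Components-construct 𝐇 Ks Ts → AllPairs (Separated Z) Ts
subtrees-separated []       []       []       = []
subtrees-separated {Z = Z} (d ∷ ds) (w ∷ ws) (c ∷ cs) = from-head d cs ∷ subtrees-separated ds ws cs
  where
  from-head : ∀ {Ls Us} → All (λ L → Empty (_ ∩ L)) Ls → Components-construct _ Ls Us →
              All (Separated Z _) Us
  from-head []       []        = []
  from-head (d ∷ ds) (c′ ∷ cs) = Separated-components d w c c′ ∷ from-head ds cs

-- A contraction singles out a subtree by its position in `Ts`; its component is therefore attached
-- to it existentially.
components-All : {Q : Subset n → Set} → All Q Ks → Components-construct 𝐇 Ks Ts →
                 All (λ T → ∃ λ K → IsConstruct (𝐇 ↾ K) K T × Q K) Ts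
components-All []       []       = []
components-All (q ∷ qs) (c ∷ cs) = (_ , c , q) ∷ components-All qs cs

subtrees-Within : IsConstruct 𝐇 H (node X Ts) → Within 𝐇 H Z → Empty (Z ∩ X) →
                  AllPairs (Separated Z) Ts ×
                  All (λ T → ∃ λ K → IsConstruct (𝐇 ↾ K) K T × Within (𝐇 ↾ K) K Z) Ts
subtrees-Within (single _) w e = [] , []
subtrees-Within (graft _ _ d cs) w e =
  subtrees-separated (IsComponents.disjoint d) ws cs , components-All ws cs
  where ws = All.tabulate (Within-component d w e)

subtrees-connected : IsConstruct 𝐇 H (node X Ts) →
                     All (λ T → ∃ λ K → IsConstruct (𝐇 ↾ K) K T ×
                                        Connected (𝐇 ↾ K) K × K ⊆ H ─ X) Ts
subtrees-connected (single _) = []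
subtrees-connected (graft _ _ d cs) = components-All (All.tabulate λ i →
  Connected-resp-≐ (↾-↾ (component-⊆ d i)) (All.lookup (IsComponents.connected d) i) ,
  λ {_} → component-⊆ d i) cs

-- The effect of a contraction on tops.

-- For non-empty finite sets and a total order: max Q ≼ max P and min Q ≼ min P.
Dominates : Rel (Fin n) 0ℓ → Rel (Pred (Fin n) 0ℓ) 0ℓ
Dominates _≼_ P Q = (∀ y → Q y → ∃ λ x → P x × y ≼ x) ×
                    (∀ x → P x → ∃ λ y → Q y × y ≼ x)

module _ {n : ℕ} {_≼_ : Rel (Fin n) 0ℓ} where

  Dominates-reflexive : Reflexive _≼_ → ∀ {P Q : Pred (Fin n) 0ℓ} →
                        (∀ {x} → P x → Q x) → (∀ {x} → Q x → P x) →
                        Dominates _≼_ P Q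
  Dominates-reflexive ≼-refl P⊆Q Q⊆P = (λ y q → y , Q⊆P q , ≼-refl) , (λ x p → x , P⊆Q p , ≼-refl)

  Dominates-trans : Transitive _≼_ → Transitive (Dominates _≼_)
  Dominates-trans ≼-trans (f , g) (f′ , g′) =
    (λ z r → let y , q , z≼y = f′ z r ; x , p , y≼x = f y q in x , p , ≼-trans z≼y y≼x) ,
    (λ x p → let y , q , y≼x = g x p ; z , r , z≼y = g′ y q in z , r , ≼-trans z≼y y≼x)

  -- Used with _≼_ for fusions, and with its converse, which swaps the
  -- arguments of Dominates, for splits.
  contraction-Dominates : Reflexive _≼_ → ∀ {X Y} → (∀ x y → x ∈ X → y ∈ Y → y ≼ x) →
                          ∀ {S T 𝐇 H Z} → Contracts X Y S T → IsConstruct 𝐇 H S →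
                          Within 𝐇 H Z → Dominates _≼_ (Top Z S) (Top Z T)
  contraction-Dominates ≼-refl {X} {Y} Y≼X {Z = Z} (here Ls Us Rs) c w
    with nonempty? (Z ∩ X) | nonempty? (Z ∩ Y)
  -- The top grows from `Z ∩ X` to `Z ∩ (X ∪ Y)`. The vertices gained lie in `Y`, hence below `x`,
  -- and none is lost.
  ... | yes (x , x∈) | _ = let x∈Z , x∈X = x∈p∩q⁻ Z X x∈ in
    ( λ { y (root y∈Z y∈X∪Y) → Sum.[ (λ y∈X → y , root y∈Z y∈X , ≼-refl)
                                   , (λ y∈Y → x , root x∈Z x∈X , Y≼X x y x∈X y∈Y) ]′ (x∈p∪q⁻ X Y y∈X∪Y)
        ; y (below e _) → ⊥-elim (e (x , x∈p∩q⁺ (x∈Z , x∈p∪q⁺ (inj₁ x∈X)))) } ) ,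
    ( λ { x′ (root x′∈Z x′∈X) → x′ , root x′∈Z (x∈p∪q⁺ (inj₁ x′∈X)) , ≼-refl
        ; x′ (below e _) → ⊥-elim (e (x , x∈)) } )
  -- The top is `Z ∩ Y` before and after; separation excludes top vertices in the siblings of `Y`.
  ... | no Z∩X=∅ | yes (z , z∈) = Dominates-reflexive ≼-refl to from
    where
    z∈Z = proj₁ (x∈p∩q⁻ Z Y z∈)
    z∈Y = proj₂ (x∈p∩q⁻ Z Y z∈)

    to : ∀ {x} → Top Z (node X (Ls ++ node Y Us ∷ Rs)) x → Top Z (node (X ∪ Y) (Ls ++ Us ++ Rs)) x
    to (root x∈Z x∈X) = root x∈Z (x∈p∪q⁺ (inj₁ x∈X))
    to (below _ t) with AllPairs-focus Separated-sym Ls (proj₁ (subtrees-Within c w Z∩X=∅)) t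
    ... | inj₁ (root x∈Z x∈Y) = root x∈Z (x∈p∪q⁺ (inj₂ x∈Y))
    ... | inj₁ (below e _)    = ⊥-elim (e (z , z∈))
    ... | inj₂ (_ , sep , t′) = ⊥-elim (sep z _ (root z∈Z z∈Y) t′)

    from : ∀ {x} → Top Z (node (X ∪ Y) (Ls ++ Us ++ Rs)) x → Top Z (node X (Ls ++ node Y Us ∷ Rs)) x
    from (root x∈Z x∈X∪Y) = Sum.[ root x∈Z , below Z∩X=∅ ∘ Any.++⁺ʳ Ls ∘ Any.here ∘ root x∈Z ]′ (x∈p∪q⁻ X Y x∈X∪Y)
    from (below e _)      = ⊥-elim (e (z , x∈p∩q⁺ (z∈Z , x∈p∪q⁺ (inj₂ z∈Y))))
  -- The search passes both labels and reaches the same subtrees `Ls`, `Us` and `Rs` before and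
  -- after.
  ... | no Z∩X=∅ | no Z∩Y=∅ = Dominates-reflexive ≼-refl to from
    where
    Z∩[X∪Y]=∅ : Empty (Z ∩ (X ∪ Y))
    Z∩[X∪Y]=∅ (x , x∈) with x∈p∩q⁻ Z (X ∪ Y) x∈
    ... | x∈Z , x∈X∪Y = Sum.[ (λ x∈X → Z∩X=∅ (x , x∈p∩q⁺ (x∈Z , x∈X)))
                            , (λ x∈Y → Z∩Y=∅ (x , x∈p∩q⁺ (x∈Z , x∈Y))) ]′ (x∈p∪q⁻ X Y x∈X∪Y)

    to : ∀ {x} → Top Z (node X (Ls ++ node Y Us ∷ Rs)) x → Top Z (node (X ∪ Y) (Ls ++ Us ++ Rs)) x
    to (root x∈Z x∈X) = ⊥-elim (Z∩X=∅ (_ , x∈p∩q⁺ (x∈Z , x∈X)))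
    to (below _ t) with Any.++⁻ Ls t
    ... | inj₁ t′                       = below Z∩[X∪Y]=∅ (Any.++⁺ˡ t′)
    ... | inj₂ (here (root x∈Z x∈Y))    = ⊥-elim (Z∩Y=∅ (_ , x∈p∩q⁺ (x∈Z , x∈Y)))
    ... | inj₂ (here (below _ t′))      = below Z∩[X∪Y]=∅ (Any.++⁺ʳ Ls (Any.++⁺ˡ t′))
    ... | inj₂ (there t′)               = below Z∩[X∪Y]=∅ (Any.++⁺ʳ Ls (Any.++⁺ʳ Us t′))

    from : ∀ {x} → Top Z (node (X ∪ Y) (Ls ++ Us ++ Rs)) x → Top Z (node X (Ls ++ node Y Us ∷ Rs)) x
    from (root x∈Z x∈X∪Y) = ⊥-elim (Z∩[X∪Y]=∅ (_ , x∈p∩q⁺ (x∈Z , x∈X∪Y)))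
    from (below _ t) with Any.++⁻ Ls t
    ... | inj₁ t′ = below Z∩X=∅ (Any.++⁺ˡ t′)
    ... | inj₂ t′ = below Z∩X=∅ (Any.++⁺ʳ Ls (Sum.[ Any.here ∘ below Z∩Y=∅ , Any.there ]′ (Any.++⁻ Us t′)))
  contraction-Dominates ≼-refl Y≼X {Z = Z} (there W Ls Rs {T} {T′} s) c w with nonempty? (Z ∩ W)
  -- The search stops at `W`, above the contraction.
  ... | yes ne = Dominates-reflexive ≼-refl (same-root ne) (same-root ne)
    where
    same-root : ∀ {Ts Us x} → Nonempty (Z ∩ W) → Top Z (node W Ts) x → Top Z (node W Us) x
    same-root ne (root x∈Z x∈W) = root x∈Z x∈W
    same-root ne (below e _)    = ⊥-elim (e ne)
  ... | no Z∩W=∅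
    with _ , c′ , w′ ← All.head (All.++⁻ʳ Ls (proj₂ (subtrees-Within c w Z∩W=∅)))
    with f , g ← contraction-Dominates ≼-refl Y≼X s c′ w′ =
    (λ { y (root y∈Z y∈W) → ⊥-elim (Z∩W=∅ (y , x∈p∩q⁺ (y∈Z , y∈W)))
       ; y (below _ t) → lift ≼-refl f y (Any-replace Ls t) }) ,
    (λ { y (root y∈Z y∈W) → ⊥-elim (Z∩W=∅ (y , x∈p∩q⁺ (y∈Z , y∈W)))
       ; y (below _ t) → lift ≼-refl g y (Any-replace Ls t) })
    where
    -- One half of `Dominates` needs `_≼_`, the other its converse, whence the generic relation.
    lift : ∀ {_~_ : Rel (Fin n) 0ℓ} {S S′} → Reflexive _~_ →
           (∀ y → Top Z S y → ∃ λ x → Top Z S′ x × y ~ x) →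
           ∀ y → Top Z S y ⊎ (∀ U → Any (λ T → Top Z T y) (Ls ++ U ∷ Rs)) →
           ∃ λ x → Top Z (node W (Ls ++ S′ ∷ Rs)) x × y ~ x
    lift ~-refl f y (inj₁ t) = let x , t′ , y~x = f y t in
                               x , below Z∩W=∅ (Any.++⁺ʳ Ls (here t′)) , y~x
    lift ~-refl f y (inj₂ t) = y , below Z∩W=∅ (t _) , ~-refl

-- Z is the vertex set of the subtree rooted at the contracted parent X.
contraction-witness : ∀ {X Y S T} → Nonempty Y → Contracts X Y S T → IsConstruct 𝐇 H S →
                      Connected (𝐇 ↾ H) H →
                      ∃ λ Z → Z ⊆ H × Connected (𝐇 ↾ Z) Z ×
                              (∃ λ x → Top Z S x) × (∀ x → Top Z S x → x ∈ X) ×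
                              (∃ λ y → y ∈ Y × Top Z T y)
contraction-witness {H = H} {X = X} (y , y∈Y) (here Ls Us Rs) c conn
  with x , x∈X ← label-nonempty c
  with _ , d , _ , K⊆H─X ← All.head (All.++⁻ʳ Ls (subtrees-connected c)) =
  -- Here `Z` is all of `H`, whose top is the root label: `X` before the contraction and `X ∪ Y`
  -- after it.
  H , (λ h → h) , conn , (x , root (label-⊆ c x∈X) x∈X) ,
  (λ { _ (root _ x∈X) → x∈X
     ; _ (below e _)  → ⊥-elim (e (x , x∈p∩q⁺ (label-⊆ c x∈X , x∈X))) }) ,
  (y , y∈Y , root (p─q⊆p H X (K⊆H─X (label-⊆ d y∈Y))) (x∈p∪q⁺ (inj₂ y∈Y)))
contraction-witness {H = H} ne (there W Ls Rs s) c conn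
  with K , d , connK , K⊆H─W ← All.head (All.++⁻ʳ Ls (subtrees-connected c))
  with Z , Z⊆K , connZ , (x , t) , top-in-X , (y , y∈Y , t′) ←
       contraction-witness ne s d (Connected-resp-≐ (≐-sym (↾-↾ (λ z∈K → z∈K))) connK) =
  Z , (λ {z} → Z⊆H {z}) , connZ′ , (x , below Z∩W=∅ (Any.++⁺ʳ Ls (here t))) ,
  (λ { _ (root z∈Z z∈W) → ⊥-elim (Z∩W=∅ (_ , x∈p∩q⁺ (z∈Z , z∈W)))
     ; _ (below _ u) → from-below u }) ,
  (y , y∈Y , below Z∩W=∅ (Any.++⁺ʳ Ls (here t′)))
  where
  Z⊆H : Z ⊆ H
  Z⊆H = p─q⊆p H W ∘ K⊆H─W ∘ Z⊆K

  connZ′ = Connected-resp-≐ (↾-↾ Z⊆K) connZ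

  Z∩W=∅ : Empty (Z ∩ W)
  Z∩W=∅ (z , z∈) = let z∈Z , z∈W = x∈p∩q⁻ Z W z∈ in x∈p─q⇒x∉q H W (K⊆H─W (Z⊆K z∈Z)) z∈W

  -- The top vertex `x` supplied by the recursive call lies in the contracted subtree, so separation
  -- leaves no top vertex in its siblings.
  from-below : ∀ {z} → Any (λ T → Top Z T z) _ → z ∈ _
  from-below u with AllPairs-focus Separated-sym Ls
                      (proj₁ (subtrees-Within c (inj₁ ((λ {z} → Z⊆H {z}) , connZ′)) Z∩W=∅)) u
  ... | inj₁ t₁            = top-in-X _ t₁
  ... | inj₂ (_ , sep , v) = ⊥-elim (sep x _ t v)

-- Contractions of non-planar trees.

module _ {n : ℕ} {_≼_ : Rel (Fin n) 0ℓ} (≼-refl : Reflexive _≼_) (≼-trans : Transitive _≼_) where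

  ≅-Dominates : ∀ {S T Z} → S ≅ T → Dominates _≼_ (Top Z S) (Top Z T)
  ≅-Dominates e = Dominates-reflexive ≼-refl (Top-resp-≅ e) (Top-resp-≅ (≅-sym e))

  ⊂-Dominates : ∀ {X Y S T 𝐇 H} → S ⊂[ X , Y ] T → IsConstruct 𝐇 H S →
                (∀ x y → x ∈ X → y ∈ Y → y ≼ x) → ∀ {Z} → Within 𝐇 H Z →
                Dominates _≼_ (Top Z S) (Top Z T)
  ⊂-Dominates (_ , _ , e , s , e′) c Y≼X w =
    Dominates-trans ≼-trans (≅-Dominates e)
      (Dominates-trans ≼-trans (contraction-Dominates ≼-refl Y≼X s (IsConstruct-resp-≅ e c) w)
        (≅-Dominates e′))

  -- For the witness `Z`, some `y` of `Y` is in the top after the contraction, while the top before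
  -- lies in `X`. The second half of the reverse domination would place some `x` of `X` below `y`.
  -- With `_≼_` this makes the minimum drop strictly along a fusion; with the converse order, the
  -- maximum along a split.
  ⊂-strict : ∀ {X Y S T 𝐇 H} → S ⊂[ X , Y ] T → IsConstruct 𝐇 H S →
             (∀ x y → x ∈ X → y ∈ Y → ¬ x ≼ y) → Nonempty Y → Connected (𝐇 ↾ H) H →
             ∃ λ Z → Within 𝐇 H Z × ¬ Dominates _≼_ (Top Z T) (Top Z S)
  ⊂-strict (_ , _ , e , s , e′) c X⋠Y ne conn
    with Z , Z⊆H , connZ , _ , top-in-X , (y , y∈Y , t) ←
         contraction-witness ne s (IsConstruct-resp-≅ e c) conn =
    Z , inj₁ ((λ {z} → Z⊆H {z}) , connZ) , λ (_ , g) →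
      let x , t′ , x≼y = g y (Top-resp-≅ e′ t) in
      X⋠Y x y (top-in-X x (Top-resp-≅ e t′)) y∈Y x≼y

-- Monotonicity along the flip order, and antisymmetry.

module _ {n : ℕ} {_≼_ : Rel (Fin n) 0ℓ} (total : IsTotalOrder _≡_ _≼_) where
  private
    module ≼ = IsTotalOrder total

  Below⇒≼ : ∀ {Y Z} → Below _≼_ Y Z → ∀ y z → y ∈ Y → z ∈ Z → y ≼ z
  Below⇒≼ (a , b , (_ , ≼a) , (_ , b≼) , a≼b , _) y z y∈Y z∈Z =
    ≼.trans (≼a y y∈Y) (≼.trans a≼b (b≼ z z∈Z))

  Below⇒⋡ : ∀ {Y Z} → Below _≼_ Y Z → ∀ y z → y ∈ Y → z ∈ Z → ¬ z ≼ y
  Below⇒⋡ (a , b , (_ , ≼a) , (_ , b≼) , a≼b , a≢b) y z y∈Y z∈Z z≼y =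
    a≢b (≼.antisym a≼b (≼.trans (b≼ z z∈Z) (≼.trans z≼y (≼a y y∈Y))))

  module _ {𝐇 : Hyperedges n} {H : Subset n} where

    Cover-Dominates : ∀ {S S′ Z} → Within 𝐇 H Z → Cover _≼_ 𝐇 H S S′ →
                      Dominates _≼_ (Top Z (proj₁ S)) (Top Z (proj₁ S′))
    Cover-Dominates {S = _ , c} w (fusion V<U S⊂S′) =
      ⊂-Dominates ≼.refl ≼.trans S⊂S′ c (λ u v u∈U v∈V → Below⇒≼ V<U v u v∈V u∈U) w
    Cover-Dominates {S′ = _ , c} w (split V<U S′⊂S) =
      -- A split is a contraction read backwards, with the child above the parent; the two reversals
      -- cancel.
      Product.swap (⊂-Dominates {_≼_ = flip _≼_} ≼.refl (flip ≼.trans) S′⊂S c (Below⇒≼ V<U) w)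

    Cover-strict : ∀ {S S′} → Connected (𝐇 ↾ H) H → Cover _≼_ 𝐇 H S S′ →
                   ∃ λ Z → Within 𝐇 H Z × ¬ Dominates _≼_ (Top Z (proj₁ S′)) (Top Z (proj₁ S))
    -- Strictness needs a vertex of the contracted child: the maximum of `V` for a fusion, the
    -- minimum of `U` for a split, both contained in `Below`.
    Cover-strict {S = _ , c} conn (fusion V<U@(v , _ , (v∈V , _) , _) S⊂S′) =
      ⊂-strict ≼.refl ≼.trans S⊂S′ c (λ u v u∈U v∈V → Below⇒⋡ V<U v u v∈V u∈U) (v , v∈V) conn
    Cover-strict {S′ = _ , c} conn (split V<U@(_ , u , _ , (u∈U , _) , _) S′⊂S)
      with Z , w , ¬dom ← ⊂-strict {_≼_ = flip _≼_} ≼.refl (flip ≼.trans) S′⊂S c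
                                   (Below⇒⋡ V<U) (u , u∈U) conn =
      Z , w , ¬dom ∘ Product.swap

    FlipOrder-Dominates : ∀ {S S′ Z} → Within 𝐇 H Z → FlipOrder _≼_ 𝐇 H S S′ →
                          Dominates _≼_ (Top Z (proj₁ S)) (Top Z (proj₁ S′))
    FlipOrder-Dominates w ε            = Dominates-reflexive ≼.refl (λ t → t) (λ t → t)
    FlipOrder-Dominates w (inj₁ e ◅ p) =
      Dominates-trans ≼.trans (≅-Dominates ≼.refl ≼.trans e) (FlipOrder-Dominates w p)
    FlipOrder-Dominates w (inj₂ c ◅ p) =
      Dominates-trans ≼.trans (Cover-Dominates w c) (FlipOrder-Dominates w p)

    FlipOrder-antisym : Connected (𝐇 ↾ H) H → ∀ {S T} →
                        FlipOrder _≼_ 𝐇 H S T → FlipOrder _≼_ 𝐇 H T S → S ≅ᶜ T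
    FlipOrder-antisym conn ε            q = ≅-refl
    -- The equality step is moved to the end of `q`, so that the two chains still close up to a
    -- cycle.
    FlipOrder-antisym conn (inj₁ e ◅ p) q = ≅-trans e (FlipOrder-antisym conn p (q ◅◅ inj₁ e ◅ ε))
    -- The rest of the cycle leads back to the source of `c` and yields the domination that
    -- `Cover-strict` refutes.
    FlipOrder-antisym conn (inj₂ c ◅ p) q with Z , w , ¬dom ← Cover-strict conn c =
      ⊥-elim (¬dom (FlipOrder-Dominates w (p ◅◅ q)))

proposition2p12 : ∀ (n : ℕ) (_≼_ : Rel (Fin n) 0ℓ) → IsTotalOrder _≡_ _≼_ →
    (𝐇 : Hyperedges n) (H : Subset n) → IsHypergraph 𝐇 H → Connected 𝐇 H →
    IsPartialOrder (_≅ᶜ_ {𝐇 = 𝐇} {H = H}) (FlipOrder _≼_ 𝐇 H)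
proposition2p12 n _≼_ total 𝐇 H hyp conn = record
  { isPreorder = record
    { isEquivalence = record { refl = ≅-refl ; sym = ≅-sym ; trans = ≅-trans }
    ; reflexive     = λ e → inj₁ e ◅ ε
    ; trans         = _◅◅_
    }
  ; antisym = FlipOrder-antisym total (Connected-resp-≐ 𝐇≐𝐇↾H conn)
  }
  where
  -- The lemmas take connectedness in the form `Connected (𝐇 ↾ H) H`, which also suits components.
  -- Restricting to `H` changes nothing, because `cover` puts every hyperedge inside `H`.
  𝐇≐𝐇↾H : 𝐇 ≐ 𝐇 ↾ H
  𝐇≐𝐇↾H = (λ {E} e → e , λ {x} x∈E →
             Equivalence.from (IsHypergraph.cover hyp x) (E , e , x∈E)) , proj₁
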